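{- Let $k$, $l$ and $m$ be non-negative integers, and let $\{H_1,H_2,\dots,H_m\}$ be a collection of $m$ distinct sets. If $m>\binom{k+l}{l}$ then at least one of the following two statements holds: (1) Among the $H_i$'s one can find a $(k+1)$-increasing sequence of sets $(H_{i_1},H_{i_2},\dots,H_{i_{k+2}})$. (2) Among the $H_i$'s one can find an $(l+1)$-decreasing sequence of sets $(H_{i_1},H_{i_2},\dots,H_{i_{l+2}})$.
   Context: A finite sequence of sets $(H_1,\dots,H_p)$ is called $(p-1)$-increasing if $H_1\subsetneq H_1\cup H_2\subsetneq\dots\subsetneq H_1\cup H_2\cup\dots\cup H_p$, and $(p-1)$-decreasing if $H_1\supsetneq H_1\cap H_2\supsetneq\dots\supsetneq H_1\cap H_2\cap\dots\cap H_p$. The sets $H_i$ are arbitrary (they need not be finite). -}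

module Defs where

open import Level using (Level)
open import Data.Nat using (ℕ; suc)
open import Data.Fin using (Fin; inject₁; _≤_) renaming (suc to fsuc)
open import Data.Product using (∃; proj₁)
open import Relation.Unary using (Pred; _⊂_; _⊃_; ⋃; ⋂)

private
  variable
    a ℓ : Level
    U : Set a

⋃≤ : ∀ {n} → (Fin n → Pred U ℓ) → Fin n → Pred U ℓ
⋃≤ S i = ⋃[ j ∶ ∃ (_≤ i) ] S (proj₁ j)

⋂≤ : ∀ {n} → (Fin n → Pred U ℓ) → Fin n → Pred U ℓ
⋂≤ S i = ⋂[ j ∶ ∃ (_≤ i) ] S (proj₁ j)

-- The index n counts the strict inclusions, so an n-increasing
-- (n-decreasing) sequence consists of n + 1 sets.

Increasing : ∀ n → (Fin (suc n) → Pred U ℓ) → Set _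
Increasing n S = ∀ (i : Fin n) → ⋃≤ S (inject₁ i) ⊂ ⋃≤ S (fsuc i)

Decreasing : ∀ n → (Fin (suc n) → Pred U ℓ) → Set _
Decreasing n S = ∀ (i : Fin n) → ⋂≤ S (inject₁ i) ⊃ ⋂≤ S (fsuc i)

{-# OPTIONS --safe #-}
-- Fix a point x lying in some, but not all, of the sets, and split the family
-- into the sets that contain x and those that do not.  An increasing sequence
-- of sets avoiding x is lengthened by appending a set that contains x, and a
-- decreasing sequence of sets containing x by appending a set that avoids it.
-- So the bound satisfies the recursion of Pascal's triangle.
module Submission where

open import Defs
open import Level using (Level; _⊔_; Lift; lift; lower)
open import Axiom.ExcludedMiddle using (ExcludedMiddle)
open import Data.Empty using (⊥-elim)
open import Data.Nat using (ℕ; zero; suc; _+_; _>_; _≤_; _<_; z<s; s≤s; _<?_)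
open import Data.Nat.Combinatorics using (_C_; nCn≡1; nCk+nC[k+1]≡[n+1]C[k+1])
open import Data.Nat.Properties
  using (+-suc; +-comm; +-mono-≤; <⇒≱; ≮⇒≥; ≤-<-trans; ≤-refl; m≤n⇒m≤1+n; m≤n⇒m≤n+o)
open import Data.Fin as Fin using (Fin; fromℕ; inject₁) renaming (suc to fsuc)
open import Data.Fin.Properties using (≤fromℕ; toℕ-inject₁)
open import Data.Fin.Relation.Unary.Top using (View; view; ‵fromℕ; ‵inject₁; view-fromℕ; view-inject₁)
open import Data.List using (List; []; _∷_; length; filter; allFin)
open import Data.List.Membership.Propositional using (_∈_)
open import Data.List.Membership.Propositional.Properties using (∈-filter⁻)
open import Data.List.Properties using (length-tabulate)
open import Data.List.Relation.Unary.All using () renaming (_∷_ to _∷ᵃ_)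
open import Data.List.Relation.Unary.AllPairs using () renaming (_∷_ to _∷ᵖ_)
open import Data.List.Relation.Unary.Any using (here; there)
open import Data.List.Relation.Unary.Unique.Propositional using (Unique)
open import Data.List.Relation.Unary.Unique.Propositional.Properties using (filter⁺; allFin⁺)
open import Data.Bool using (true; false)
open import Data.Product using (∃; ∃-syntax; _×_; _,_; proj₁; proj₂)
open import Data.Sum as Sum using (_⊎_; inj₁; inj₂)
open import Function using (_∘_; id)
open import Function.Definitions using (Injective)
open import Relation.Binary.PropositionalEquality using (_≡_; refl; sym; trans; cong; subst; subst₂)
open import Relation.Nullary using (¬_; yes; no; does)
open import Relation.Nullary.Decidable using (map′; decidable-stable)
open import Relation.Unary using (Pred; _≐_; _⊆_; ∁; Decidable)
open import Relation.Unary.Properties using (∁?)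

private
  variable
    a ℓ ℓ₁ ℓ₂ : Level
    I : Set
    U : Set a
    n : ℕ

-- The summands stand in the order of `length-filter-∁`: the first bounds the sets avoiding the
-- chosen point, the second those containing it.
pascal : ∀ k l → (suc k + suc l) C suc l ≡ (k + suc l) C suc l + (suc k + l) C l
pascal k l = trans (sym (nCk+nC[k+1]≡[n+1]C[k+1] (k + suc l) l))
  (trans (+-comm ((k + suc l) C l) _)
         (cong (λ n → (k + suc l) C suc l + n C l) (+-suc k l)))

-- Ensures that a list longer than the bound has at least two entries, as `distinguish` demands.
0<[k+l]Cl : ∀ k l → 0 < (k + l) C l
0<[k+l]Cl zero    l       = subst (0 <_) (sym (nCn≡1 l)) z<s
0<[k+l]Cl (suc k) zero    = z<s
0<[k+l]Cl (suc k) (suc l) =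
  subst (0 <_) (sym (pascal k l)) (m≤n⇒m≤n+o _ (0<[k+l]Cl k (suc l)))

m+n<o+p⇒m<o⊎n<p : ∀ {m n o p} → m + n < o + p → m < o ⊎ n < p
m+n<o+p⇒m<o⊎n<p {m} {n} {o} {p} lt with m <? o | n <? p
... | yes m<o | _       = inj₁ m<o
... | no  _   | yes n<p = inj₂ n<p
... | no  m≮o | no  n≮p = ⊥-elim (<⇒≱ lt (+-mono-≤ (≮⇒≥ m≮o) (≮⇒≥ n≮p)))

length-filter-∁ : {P : Pred I ℓ} (P? : Decidable P) (xs : List I) →
  length xs ≡ length (filter (∁? P?) xs) + length (filter P? xs)
length-filter-∁ P? []       = refl
length-filter-∁ P? (x ∷ xs) with does (P? x)
... | true  = trans (cong suc (length-filter-∁ P? xs)) (sym (+-suc _ _))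
... | false = cong suc (length-filter-∁ P? xs)

_∷ʳ_ : (Fin n → I) → I → Fin (suc n) → I
(s ∷ʳ y) i with view i
... | ‵fromℕ     = y
... | ‵inject₁ j = s j

∷ʳ-fromℕ : (s : Fin n → I) (y : I) → (s ∷ʳ y) (fromℕ n) ≡ y
∷ʳ-fromℕ {n} s y rewrite view-fromℕ n = refl

∷ʳ-inject₁ : (s : Fin n → I) (y : I) (i : Fin n) → (s ∷ʳ y) (inject₁ i) ≡ s i
∷ʳ-inject₁ s y i rewrite view-inject₁ i = refl

-- With Q the complement of P, this says that the unions of the initial
-- segments of P ∘ s increase strictly; with P the complement of Q, that the
-- intersections of the initial segments of Q ∘ s decrease strictly.
Separated : (I → Pred U ℓ₁) → (I → Pred U ℓ₂) → (Fin (suc n) → I) → Set _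
Separated P Q s = ∀ i → ∃ λ x → P (s (fsuc i)) x × (∀ j → j Fin.< fsuc i → Q (s j) x)

-- Separation at an index concerns earlier entries only, so old indices keep their witnesses; `x`
-- serves the new last index.
∷ʳ-separated : (P : I → Pred U ℓ₁) (Q : I → Pred U ℓ₂) {s : Fin (suc n) → I} {y : I} {x : U} →
  Separated P Q s → P y x → (∀ i → Q (s i) x) → Separated P Q (s ∷ʳ y)
∷ʳ-separated {n = n} P Q {s} {y} {x} sep Pyx Qsx = separated ∘ view
  where
  separated : ∀ {i} → View i →
    ∃ λ z → P ((s ∷ʳ y) (fsuc i)) z × (∀ j → j Fin.< fsuc i → Q ((s ∷ʳ y) j) z)
  separated ‵fromℕ = x , subst (λ v → P v x) (sym (∷ʳ-fromℕ s y)) Pyx , before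
    where
    before : ∀ j → j Fin.< fromℕ (suc n) → Q ((s ∷ʳ y) j) x
    before j j< with view j
    ... | ‵fromℕ     = ⊥-elim (<⇒≱ j< ≤-refl)
    ... | ‵inject₁ k = Qsx k
  separated (‵inject₁ i) with sep i
  ... | z , Pz , Qz = z , subst (λ v → P v z) (sym (∷ʳ-inject₁ s y (fsuc i))) Pz , before
    where
    before : ∀ j → j Fin.< inject₁ (fsuc i) → Q ((s ∷ʳ y) j) z
    before j j< with view j
    ... | ‵fromℕ     = ⊥-elim (<⇒≱ j< (≤fromℕ (inject₁ (fsuc i))))
    ... | ‵inject₁ k = Qz k (subst₂ _<_ (toℕ-inject₁ k) (toℕ-inject₁ (fsuc i)) j<)

-- The sequence may visit `xs` in any order, so an appended entry can come from anywhere in the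
-- list.
SeparatedIn : ℕ → (I → Pred U ℓ₁) → (I → Pred U ℓ₂) → List I → Set _
SeparatedIn {I = I} n P Q xs =
  ∃ λ (s : Fin (suc n) → I) → (∀ i → s i ∈ xs) × Separated P Q s

-- Generic in `P` and `Q`, so that exchanging them turns the increasing case into the decreasing
-- one.
module Separations (P : I → Pred U ℓ₁) (Q : I → Pred U ℓ₂) where

  singleton : ∀ y → SeparatedIn 0 P Q (y ∷ [])
  singleton y = (λ _ → y) , (λ _ → here refl) , λ ()

  ⊆-separatedIn : ∀ {xs ys} → (∀ {v} → v ∈ ys → v ∈ xs) →
    SeparatedIn n P Q ys → SeparatedIn n P Q xs
  ⊆-separatedIn ys⊆xs (s , s∈ , sep) = s , ys⊆xs ∘ s∈ , sep

  append : ∀ {xs ys y x} → (∀ {v} → v ∈ ys → v ∈ xs × Q v x) → y ∈ xs → P y x →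
    SeparatedIn n P Q ys → SeparatedIn (suc n) P Q xs
  append {n = n} {xs = xs} {y = y} sub y∈ Pyx (s , s∈ , sep) =
    s ∷ʳ y , s∷ʳy∈ , ∷ʳ-separated P Q sep Pyx (λ i → proj₂ (sub (s∈ i)))
    where
    s∷ʳy∈ : ∀ i → (s ∷ʳ y) i ∈ xs
    s∷ʳy∈ i with view i
    ... | ‵fromℕ     = y∈
    ... | ‵inject₁ k = proj₁ (sub (s∈ k))

inject₁≤ : {i : Fin n} {j : Fin (suc n)} → j Fin.≤ inject₁ i → j Fin.≤ fsuc i
inject₁≤ {i = i} j≤i = m≤n⇒m≤1+n (subst (_ ≤_) (toℕ-inject₁ i) j≤i)

inject₁< : {i : Fin n} {j : Fin (suc n)} → j Fin.≤ inject₁ i → j Fin.< fsuc i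
inject₁< {i = i} j≤i = s≤s (subst (_ ≤_) (toℕ-inject₁ i) j≤i)

-- The witness `x` enters the union exactly at index `fsuc i`, so the larger union is not included
-- in the smaller.
separated⇒increasing : (H : I → Pred U ℓ) {s : Fin (suc n) → I} →
  Separated H (∁ ∘ H) s → Increasing n (H ∘ s)
separated⇒increasing H sep i with sep i
... | x , Hx , ¬Hx =
  (λ { ((j , j≤i) , h) → (j , inject₁≤ j≤i) , h }) ,
  λ ⊇ → let ((j , j≤i) , h) = ⊇ ((fsuc i , ≤-refl) , Hx) in ¬Hx j (inject₁< j≤i) h

separated⇒decreasing : (H : I → Pred U ℓ) {s : Fin (suc n) → I} →
  Separated (∁ ∘ H) H s → Decreasing n (H ∘ s)
separated⇒decreasing H sep i with sep i
... | x , ¬Hx , Hx =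
  (λ h (j , j≤i) → h (j , inject₁≤ j≤i)) ,
  λ ⊆ → ¬Hx (⊆ {x} (λ (j , j≤i) → Hx j (inject₁< j≤i)) (fsuc i , ≤-refl))

module _ {a ℓ : Level} (em : ExcludedMiddle (a ⊔ ℓ)) {U : Set a} where

  classical : (P : Pred U ℓ) → Decidable P
  -- `Lift` raises `P x` to the level at which `em` decides.
  classical P x = map′ lower lift (em {Lift a (P x)})

  ⊆⊎∃ : (P Q : Pred U ℓ) → P ⊆ Q ⊎ ∃ λ x → P x × ¬ Q x
  ⊆⊎∃ P Q with em {∃ λ x → P x × ¬ Q x}
  ... | yes p = inj₂ p
  ... | no ¬p = inj₁ λ {x} Px → decidable-stable (classical Q x) (λ ¬Qx → ¬p (x , Px , ¬Qx))

  module _ {I : Set} (H : I → Pred U ℓ) (H-inj : Injective _≡_ _≐_ H) where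

    private
      module Inc = Separations H (∁ ∘ H)
      module Dec = Separations (∁ ∘ H) H

    -- Two different indices carry extensionally different sets by `H-inj`, so one of the two
    -- inclusions between them fails, and a point where it fails serves as `x`.
    distinguish : ∀ {xs} → Unique xs → 1 < length xs →
      ∃ λ x → (∃ λ A → A ∈ xs × H A x) × (∃ λ B → B ∈ xs × ¬ H B x)
    distinguish {_ ∷ []}    _                     (s≤s ())
    distinguish {A ∷ B ∷ _} ((A≢B ∷ᵃ _) ∷ᵖ _) _
      with ⊆⊎∃ (H A) (H B) | ⊆⊎∃ (H B) (H A)
    ... | inj₂ (x , HA , ¬HB) | _ = x , (A , here refl , HA) , (B , there (here refl) , ¬HB)
    ... | inj₁ _ | inj₂ (x , HB , ¬HA) = x , (B , there (here refl) , HB) , (A , here refl , ¬HA)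
    ... | inj₁ A⊆B | inj₁ B⊆A = ⊥-elim (A≢B (H-inj (A⊆B , B⊆A)))

    separatedIn : ∀ k l {xs} → Unique xs → length xs > (k + l) C l →
      SeparatedIn (suc k) H (∁ ∘ H) xs ⊎ SeparatedIn (suc l) (∁ ∘ H) H xs
    separatedIn k l {xs} uniq lt with distinguish uniq (≤-<-trans (0<[k+l]Cl k l) lt)
    ... | x , (A , A∈ , HA) , (B , B∈ , ¬HB) = step k l lt
      where
      H? : Decidable (λ i → H i x)
      H? i = classical (H i) x

      step : ∀ k l → length xs > (k + l) C l →
        SeparatedIn (suc k) H (∁ ∘ H) xs ⊎ SeparatedIn (suc l) (∁ ∘ H) H xs
      -- A single inclusion is wanted, and the pair `B`, `A` provides it: `x` is missing from the
      -- first and lies in the second. The next case reverses the pair.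
      step zero    l       _ = inj₁ (Inc.append (λ { (here refl) → B∈ , ¬HB }) A∈ HA (Inc.singleton B))
      step (suc k) zero    _ = inj₂ (Dec.append (λ { (here refl) → A∈ , HA }) B∈ ¬HB (Dec.singleton A))
      step (suc k) (suc l) lt
        with m+n<o+p⇒m<o⊎n<p (subst₂ _<_ (pascal k l) (length-filter-∁ H? xs) lt)
      -- Among the sets avoiding `x`, an increasing sequence is one inclusion short and `A` supplies
      -- it; a decreasing one already has full length.
      ... | inj₁ lt′ = Sum.map (Inc.append (∈-filter⁻ (∁? H?)) A∈ HA)
                               (Dec.⊆-separatedIn (proj₁ ∘ ∈-filter⁻ (∁? H?)))
                               (separatedIn k (suc l) (filter⁺ (∁? H?) uniq) lt′)
      -- Among the sets containing `x`, the decreasing sequence is the short one, and `B` completes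
      -- it.
      ... | inj₂ lt′ = Sum.map (Inc.⊆-separatedIn (proj₁ ∘ ∈-filter⁻ H?))
                               (Dec.append (∈-filter⁻ H?) B∈ ¬HB)
                               (separatedIn (suc k) l (filter⁺ H? uniq) lt′)

lemma1 : ∀ {a ℓ : Level} → ExcludedMiddle (a ⊔ ℓ) →
    ∀ (k l m : ℕ) {U : Set a} (H : Fin m → Pred U ℓ) →
    Injective _≡_ _≐_ H →
    m > (k + l) C l →
    (∃[ i ] Increasing (suc k) (H ∘ i)) ⊎ (∃[ i ] Decreasing (suc l) (H ∘ i))
lemma1 em k l m H H-inj m>C =
  Sum.map (λ (s , _ , sep) → s , separated⇒increasing H sep)
          (λ (s , _ , sep) → s , separated⇒decreasing H sep)
          (separatedIn em H H-inj k l (allFin⁺ m)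
            (subst (_> (k + l) C l) (sym (length-tabulate id)) m>C))
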